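{- There is an infinite family $\mathcal{F}$ of connected acyclic digraphs, containing digraphs of arbitrarily large order, such that $\bar{s}_{\mathrm{co}}(D)=O(\sqrt{n})$ and $\bar{s}_{\mathrm{cc}}(D)=O(\sqrt{n})$ for each $D\in\mathcal{F}$, where $n$ is the order of $D$. That is, there is an absolute constant $K>0$ such that for every $D\in\mathcal{F}$ of order $n$, the average size of a convex set of $D$ satisfies $\bar{s}_{\mathrm{co}}(D)\le K\sqrt{n}$ and the average size of a connected convex set of $D$ satisfies $\bar{s}_{\mathrm{cc}}(D)\le K\sqrt{n}$.
   Context: All digraphs are finite; the order of a digraph is its number of vertices. A digraph is acyclic if it has no directed cycle, and connected if its underlying undirected graph is connected. Let $D$ be an acyclic digraph. A non-empty set $X$ of vertices of $D$ is connected if the underlying undirected graph of the induced subdigraph $D[X]$ is connected. A non-empty set $X$ of vertices of $D$ is convex if there is no directed path in $D$ between two vertices of $X$ that contains a vertex not in $X$. A connected convex set is a set that is both connected and convex. Let $\mathcal{CO}(D)$ be the set of all convex sets of $D$ and $\mathcal{CC}(D)$ the set of all connected convex sets of $D$, with $\mathrm{co}(D)=|\mathcal{CO}(D)|$ and $\mathrm{cc}(D)=|\mathcal{CC}(D)|$. The average sizes are $\bar{s}_{\mathrm{co}}(D)=\frac{1}{\mathrm{co}(D)}\sum_{C\in\mathcal{CO}(D)}|C|$ and $\bar{s}_{\mathrm{cc}}(D)=\frac{1}{\mathrm{cc}(D)}\sum_{C\in\mathcal{CC}(D)}|C|$. -}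

module Defs where

open import Data.Bool.Base using (Bool; T)
open import Data.Bool.Properties using (T?)
open import Data.Fin.Base using (Fin; zero; suc)
open import Data.Fin.Properties using (_≟_; all?; any?; injective⇒≤)
open import Data.Fin.Subset using (Subset; Nonempty; _∈_; _∉_; ∣_∣; inside; outside)
open import Data.Fin.Subset.Properties using (nonempty?; _∈?_)
open import Data.Integer.Base using (+_)
open import Data.List.Base using (List; []; _∷_; _++_; map; filter; length; lookup)
open import Data.List.Relation.Unary.All as All using ([]; _∷_)
import Data.List.Relation.Unary.Any as Any
open import Data.List.Relation.Unary.Any using (Any; here; there)
open import Data.List.Relation.Unary.AllPairs using ([]; _∷_)
open import Data.List.Relation.Unary.All.Properties using (¬Any⇒All¬)
open import Data.List.Relation.Unary.Unique.Propositional using (Unique)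
open import Data.List.Relation.Unary.Unique.DecPropositional using (unique?)
import Data.List.Membership.Propositional as List
open import Data.List.Membership.Propositional.Properties using (∈-lookup)
open import Data.Nat.Base as ℕ using (ℕ; zero; suc; z≤n; s≤s)
open import Data.Nat.ListAction using (sum)
open import Data.Product.Base using (∃; ∃-syntax; _×_; _,_)
open import Data.Rational.Base as ℚ using (ℚ; 0ℚ; _/_)
open import Data.Sum.Base using (_⊎_; inj₁; inj₂; [_,_]′)
import Data.Vec.Base as Vec
open import Level using (0ℓ)
open import Relation.Binary.Core using (Rel)
open import Relation.Binary.Definitions using (Decidable)
open import Relation.Binary.Construct.Closure.Equivalence using (EqClosure)
open import Relation.Binary.Construct.Closure.ReflexiveTransitive using (Star; ε; _◅_)
open import Relation.Binary.Construct.Closure.Symmetric using (SymClosure; fwd; bwd)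
open import Relation.Binary.PropositionalEquality.Core using (_≡_; refl; sym; cong)
open import Relation.Nullary using (¬_; Dec; yes; no; contradiction)
open import Relation.Nullary.Decidable using (map′; ¬?; _×-dec_; _⊎-dec_; _→-dec_)
import Relation.Unary as U

-- The list index is the vertex sequence, endpoints included.
data Walk {A : Set} (R : Rel A 0ℓ) : A → A → List A → Set where
  stop : ∀ {u} → Walk R u u (u ∷ [])
  step : ∀ {u v w p} → R u v → Walk R v w p → Walk R u w (u ∷ p)

Path : {A : Set} (R : Rel A 0ℓ) → A → A → List A → Set
Path R u w p = Walk R u w p × Unique p

-- Loops and 2-cycles are permitted here; `Acyclic` excludes them.
record Digraph : Set where
  field
    order : ℕ
    arc   : Fin order → Fin order → Bool

  Vertex : Set
  Vertex = Fin order

  Arc : Rel Vertex 0ℓ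
  Arc u v = T (arc u v)

open Digraph public

module _ (D : Digraph) where

  -- A directed cycle is a directed path closed up by an arc from its last
  -- vertex to its first; a one-vertex path gives a loop.
  Acyclic : Set
  Acyclic = ¬ (∃[ u ] ∃[ w ] ∃[ p ] (Path (Arc D) u w p × Arc D w u))

  Connected : Set
  Connected = 0 ℕ.< order D × (∀ u v → EqClosure (Arc D) u v)

  -- The arcs of the induced subdigraph D[X].
  InducedArc : Subset (order D) → Rel (Vertex D) 0ℓ
  InducedArc X u v = u ∈ X × v ∈ X × Arc D u v

  ConnectedSet : Subset (order D) → Set
  ConnectedSet X =
    Nonempty X × (∀ u v → u ∈ X → v ∈ X → EqClosure (InducedArc X) u v)

  ConvexSet : Subset (order D) → Set
  ConvexSet X =
    Nonempty X ×
    ¬ (∃[ u ] ∃[ w ] ∃[ p ]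
         (u ∈ X × w ∈ X × Path (Arc D) u w p × Any (_∉ X) p))

  ConnectedConvexSet : Subset (order D) → Set
  ConnectedConvexSet X = ConnectedSet X × ConvexSet X

walk? : ∀ {n} {R : Rel (Fin n) 0ℓ} → Decidable R → ∀ u w p → Dec (Walk R u w p)
walk? R? u w []      = no λ ()
walk? {R = R} R? u w (x ∷ p) with u ≟ x
... | no u≢x   = no λ { stop → u≢x refl ; (step _ _) → u≢x refl }
... | yes refl with p
...   | []     = map′ (λ { refl → stop }) (λ { stop → refl ; (step _ ()) }) (u ≟ w)
...   | y ∷ q  = map′ (λ (r , s) → step r s) from (R? u y ×-dec walk? R? y w (y ∷ q))
  where
  from : Walk R u w (u ∷ y ∷ q) → R u y × Walk R y w (y ∷ q)
  from (step r stop)         = r , stop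
  from (step r s@(step _ _)) = r , s

lookup-injective : ∀ {A : Set} {p : List A} → Unique p →
                   ∀ i j → lookup p i ≡ lookup p j → i ≡ j
lookup-injective (_ ∷ _)   zero    zero    _  = refl
lookup-injective (x∉p ∷ _) zero    (suc j) eq = contradiction eq (All.lookup x∉p (∈-lookup j))
lookup-injective (x∉p ∷ _) (suc i) zero    eq = contradiction (sym eq) (All.lookup x∉p (∈-lookup i))
lookup-injective (_ ∷ p!)  (suc i) (suc j) eq = cong suc (lookup-injective p! i j eq)

unique⇒length≤ : ∀ {n} {p : List (Fin n)} → Unique p → length p ℕ.≤ n
unique⇒length≤ {p = p} p! = injective⇒≤ {f = lookup p} (lookup-injective p! _ _)

boundedList? : ∀ {n} {P : U.Pred (List (Fin n)) 0ℓ} → U.Decidable P →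
               ∀ k → Dec (∃[ p ] (length p ℕ.≤ k × P p))
boundedList? P? zero =
  map′ (λ x → [] , z≤n , x) (λ { ([] , _ , x) → x }) (P? [])
boundedList? P? (suc k) =
  map′ [ (λ x → [] , z≤n , x) , (λ (v , p , l , x) → v ∷ p , s≤s l , x) ]′
       (λ { ([] , _ , x) → inj₁ x ; (v ∷ p , s≤s l , x) → inj₂ (v , p , l , x) })
       (P? [] ⊎-dec any? λ v → boundedList? (λ p → P? (v ∷ p)) k)

path-such-that? : ∀ {n} {R : Rel (Fin n) 0ℓ} {P : U.Pred (List (Fin n)) 0ℓ} →
                  Decidable R → U.Decidable P →
                  ∀ u w → Dec (∃[ p ] (Path R u w p × P p))
path-such-that? {n} R? P? u w =
  map′ (λ (p , _ , x) → p , x)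
       (λ (p , (s , p!) , x) → p , unique⇒length≤ p! , (s , p!) , x)
       (boundedList? (λ p → (walk? R? u w p ×-dec unique? _≟_ p) ×-dec P? p) n)

private
  module _ {n} {R : Rel (Fin n) 0ℓ} where

    suffix : ∀ {v w x p} → Path R v w p → x List.∈ p → ∃ (Path R x w)
    suffix (stop     , p!)     (here refl)   = _ , stop , p!
    suffix (step r s , p!)     (here refl)   = _ , step r s , p!
    suffix (step r s , _ ∷ p!) (there x∈p)   = suffix (s , p!) x∈p

    star⇒path : ∀ {u w} → Star R u w → ∃ (Path R u w)
    star⇒path ε = _ , stop , [] ∷ []
    star⇒path {u} (r ◅ rs) with star⇒path rs
    ... | p , s , p! with Any.any? (u ≟_) p
    ...   | yes u∈p = suffix (s , p!) u∈p
    ...   | no  u∉p = u ∷ p , step r s , ¬Any⇒All¬ p u∉p ∷ p!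

    walk⇒star : ∀ {u w p} → Walk R u w p → Star R u w
    walk⇒star stop       = ε
    walk⇒star (step r s) = r ◅ walk⇒star s

star? : ∀ {n} {R : Rel (Fin n) 0ℓ} → Decidable R → Decidable (Star R)
star? R? u w =
  map′ (λ (_ , (s , _) , _) → walk⇒star s)
       (λ rs → let p , x = star⇒path rs in p , x , refl)
       (path-such-that? {P = λ p → p ≡ p} R? (λ _ → yes refl) u w)

eqClosure? : ∀ {n} {R : Rel (Fin n) 0ℓ} → Decidable R → Decidable (EqClosure R)
eqClosure? R? = star? λ u v →
  map′ [ fwd , bwd ]′ (λ { (fwd r) → inj₁ r ; (bwd r) → inj₂ r })
       (R? u v ⊎-dec R? v u)

module _ (D : Digraph) where

  arc? : Decidable (Arc D)
  arc? u v = T? (arc D u v)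

  connectedSet? : U.Decidable (ConnectedSet D)
  connectedSet? X =
    nonempty? X ×-dec all? λ u → all? λ v →
      u ∈? X →-dec (v ∈? X →-dec eqClosure? induced? u v)
    where
    induced? : Decidable (InducedArc D X)
    induced? u v = u ∈? X ×-dec (v ∈? X ×-dec arc? u v)

  convexSet? : U.Decidable (ConvexSet D)
  convexSet? X =
    nonempty? X ×-dec ¬? (any? λ u → any? λ w →
      map′ (λ ((a , b) , p , s , x) → p , a , b , s , x)
           (λ (p , a , b , s , x) → (a , b) , p , s , x)
           ((u ∈? X ×-dec w ∈? X) ×-dec
            path-such-that? arc? (Any.any? λ v → ¬? (v ∈? X)) u w))

  connectedConvexSet? : U.Decidable (ConnectedConvexSet D)
  connectedConvexSet? X = connectedSet? X ×-dec convexSet? X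

allSubsets : ∀ n → List (Subset n)
allSubsets zero    = Vec.[] ∷ []
allSubsets (suc n) =
  map (outside Vec.∷_) (allSubsets n) ++ map (inside Vec.∷_) (allSubsets n)

CO CC : (D : Digraph) → List (Subset (order D))
CO D = filter (convexSet? D) (allSubsets (order D))
CC D = filter (connectedConvexSet? D) (allSubsets (order D))

-- The value on [] is a junk value.  CO D and CC D are [] only if D has no
-- vertices, since every singleton of an acyclic digraph is connected and convex.
average : List ℕ → ℚ
average []           = 0ℚ
average xs@(_ ∷ _) = + sum xs / length xs

s̄co s̄cc : Digraph → ℚ
s̄co D = average (map ∣_∣ (CO D))
s̄cc D = average (map ∣_∣ (CC D))

-- q ≤ K √n, with the irrational √n eliminated by squaring both sides.  This
-- reading is valid for q ≥ 0 and K ≥ 0, the only case in which it is used.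
_≤[_]√_ : ℚ → ℚ → ℕ → Set
q ≤[ K ]√ n = q ℚ.* q ℚ.≤ K ℚ.* K ℚ.* (+ n / 1)

{-# OPTIONS --safe #-}
-- Take the ordinal sum of two antichains of t + 1 vertices and a chain of m
-- vertices.  There are at least 2ᵗ 2ᵗ connected convex sets inside the two
-- antichains, all of size at most 2 (t + 1).  A convex set meeting the chain
-- either misses the first antichain or contains the whole second one, and it
-- meets the chain in an interval, so that there are at most 4 · 2ᵗ (m + 1)²
-- such sets.  With m = s² and t = 6 s they contribute O(1) to the average,
-- whereas n ≥ s² and 2 (t + 1) = O(s).
module Submission where

open import Defs
open import Data.Bool.Base using (Bool)
open import Data.Fin.Base using (Fin; zero; suc; toℕ; _↑ˡ_; _↑ʳ_; splitAt)
open import Data.Fin.Properties using (splitAt-↑ˡ; splitAt-↑ʳ; splitAt⁻¹-↑ʳ)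
open import Data.Fin.Subset using (Subset; inside; outside; _∈_; _∉_; ∣_∣; ⊥; ⊤; Nonempty)
open import Data.Fin.Subset.Properties
  using (Empty-unique; nonempty?; drop-there; ∣⊥∣≡0; ∣p∣≤n; ∉⊥; ⊆⊤; ⊆-antisym; _∈?_)
open import Data.Integer.Base as ℤ using (+_)
import Data.Integer.Properties as ℤ
open import Data.List.Base as List using (List; []; _∷_; filter; length)
open import Data.List.Properties using (map-++; map-∘; length-map)
open import Data.List.Relation.Unary.All using ([]; _∷_)
open import Data.List.Relation.Unary.AllPairs using ([]; _∷_)
open import Data.List.Relation.Unary.Any using (Any; here; there)
open import Data.Nat.Base as ℕ using (ℕ; zero; suc; _+_; _*_; _^_; _≤_; _<_; _<ᵇ_; z≤n; s≤s)
open import Data.Nat.ListAction using (sum)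
open import Data.Nat.ListAction.Properties using (sum-++)
open import Data.Nat.Properties
open import Data.Nat.Tactic.RingSolver using (solve-∀)
open import Data.Product.Base using (Σ-syntax; ∃-syntax; _×_; _,_; proj₁; proj₂)
open import Data.Rational.Base as ℚ using (ℚ; 0ℚ)
import Data.Rational.Properties as ℚ
import Data.Rational.Unnormalised.Base as ℚᵘ
import Data.Rational.Unnormalised.Properties as ℚᵘ
open import Data.Sum.Base using (_⊎_; inj₁; inj₂; [_,_]′)
open import Data.Unit.Base using (tt) renaming (⊤ to Unit)
open import Data.Vec.Base as Vec using ([]; _∷_; _++_)
open import Data.Vec.Properties using ([]=⇒lookup; lookup⇒[]=; lookup-++ˡ; lookup-++ʳ)
open import Function.Base using (_∘_; const)
open import Level using (0ℓ)
open import Relation.Binary.Construct.Closure.Equivalence using (EqClosure)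
open import Relation.Binary.Construct.Closure.ReflexiveTransitive using (ε; _◅_; _◅◅_)
open import Relation.Binary.Construct.Closure.Symmetric using (fwd; bwd)
open import Relation.Binary.Core using (Rel)
open import Relation.Binary.Definitions using (tri<; tri≈; tri>)
open import Relation.Binary.PropositionalEquality
  using (_≡_; refl; sym; trans; cong; cong₂; subst; module ≡-Reasoning)
open import Relation.Nullary using (¬_; Dec; yes; no; contradiction)
open import Relation.Nullary.Decidable using (decidable-stable)
open import Relation.Unary using (Pred; Decidable)

-- Sums over subsets

-- The recursion follows that of `allSubsets`, so lists are left behind after `sum-allSubsets`, and
-- a sum over concatenated blocks becomes a nested sum by induction on the first block.
∑ : ∀ n → (Subset n → ℕ) → ℕ
∑ zero    f = f []
∑ (suc n) f = ∑ n (f ∘ (outside ∷_)) + ∑ n (f ∘ (inside ∷_))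

∑-mono : ∀ n {f g} → (∀ X → f X ≤ g X) → ∑ n f ≤ ∑ n g
∑-mono zero    f≤g = f≤g []
∑-mono (suc n) f≤g = +-mono-≤ (∑-mono n (f≤g ∘ (outside ∷_))) (∑-mono n (f≤g ∘ (inside ∷_)))

∑-const : ∀ n c → ∑ n (const c) ≡ 2 ^ n * c
∑-const zero    c = sym (*-identityˡ c)
∑-const (suc n) c rewrite ∑-const n c = double (2 ^ n) c
  where
  double : ∀ p c → p * c + p * c ≡ 2 * p * c
  double = solve-∀

∑-++ : ∀ a {b} f → ∑ (a + b) f ≡ ∑ a λ S → ∑ b λ T → f (S ++ T)
∑-++ zero    f = refl
∑-++ (suc a) f = cong₂ _+_ (∑-++ a (f ∘ (outside ∷_))) (∑-++ a (f ∘ (inside ∷_)))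

∑-cong : ∀ n {f g} → (∀ X → f X ≡ g X) → ∑ n f ≡ ∑ n g
∑-cong zero    f≡g = f≡g []
∑-cong (suc n) f≡g = cong₂ _+_ (∑-cong n (f≡g ∘ (outside ∷_))) (∑-cong n (f≡g ∘ (inside ∷_)))

∑-++³ : ∀ a b {c} f → ∑ (a + (b + c)) f ≡ ∑ a λ S → ∑ b λ T → ∑ c λ U → f (S ++ (T ++ U))
∑-++³ a b f = trans (∑-++ a f) (∑-cong a λ S → ∑-++ b (λ Y → f (S ++ Y)))

term≤∑ : ∀ n f X → f X ≤ ∑ n f
term≤∑ zero    f []            = ≤-refl
term≤∑ (suc n) f (outside ∷ X) = ≤-trans (term≤∑ n (f ∘ (outside ∷_)) X) (m≤m+n _ _)
term≤∑ (suc n) f (inside ∷ X)  = ≤-trans (term≤∑ n (f ∘ (inside ∷_)) X) (m≤n+m _ _)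

-- The shape "count times `c` plus `d` times indicator" survives summation unchanged, so the lemma
-- can be nested, once for each block of vertices.
∑-linear-≤ : ∀ n {f} g h c d → (∀ X → f X ≤ g X * c + d * h X) →
             ∑ n f ≤ ∑ n g * c + d * ∑ n h
∑-linear-≤ zero    g h c d f≤ = f≤ []
∑-linear-≤ (suc n) g h c d f≤ =
  ≤-trans (+-mono-≤ (∑-linear-≤ n (g ∘ (outside ∷_)) (h ∘ (outside ∷_)) c d (f≤ ∘ (outside ∷_)))
                    (∑-linear-≤ n (g ∘ (inside ∷_)) (h ∘ (inside ∷_)) c d (f≤ ∘ (inside ∷_))))
          (≤-reflexive (regroup (∑ n (g ∘ (outside ∷_))) (∑ n (g ∘ (inside ∷_)))
                                (∑ n (h ∘ (outside ∷_))) (∑ n (h ∘ (inside ∷_))) c d))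
  where
  regroup : ∀ g₀ g₁ h₀ h₁ c d →
            g₀ * c + d * h₀ + (g₁ * c + d * h₁) ≡ (g₀ + g₁) * c + d * (h₀ + h₁)
  regroup = solve-∀

-- Sums and lengths of filtered lists of subsets

weight : {A : Set} → Dec A → ℕ → ℕ
weight (yes _) k = k
weight (no _)  _ = 0

sum-allSubsets : ∀ n f → sum (List.map f (allSubsets n)) ≡ ∑ n f
sum-allSubsets zero    f = +-identityʳ (f [])
sum-allSubsets (suc n) f = begin
  sum (List.map f (half outside List.++ half inside))
    ≡⟨ cong sum (map-++ f (half outside) (half inside)) ⟩
  sum (List.map f (half outside) List.++ List.map f (half inside))
    ≡⟨ sum-++ (List.map f (half outside)) (List.map f (half inside)) ⟩
  sum (List.map f (half outside)) + sum (List.map f (half inside))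
    ≡⟨ cong₂ _+_ (sum-half outside) (sum-half inside) ⟩
  ∑ (suc n) f ∎
  where
  open ≡-Reasoning
  half : Bool → List (Subset (suc n))
  half b = List.map (b ∷_) (allSubsets n)
  sum-half : ∀ b → sum (List.map f (half b)) ≡ ∑ n (f ∘ (b ∷_))
  sum-half b = trans (cong sum (sym (map-∘ (allSubsets n)))) (sum-allSubsets n (f ∘ (b ∷_)))

sum-map-filter : {A : Set} {P : Pred A 0ℓ} (P? : Decidable P) (f : A → ℕ) (xs : List A) →
  sum (List.map f (filter P? xs)) ≡ sum (List.map (λ x → weight (P? x) (f x)) xs)
sum-map-filter P? f []       = refl
sum-map-filter P? f (x ∷ xs) with P? x
... | yes _ = cong (λ k → f x + k) (sum-map-filter P? f xs)
... | no _  = sum-map-filter P? f xs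

sum-filter : ∀ n {P : Pred (Subset n) 0ℓ} (P? : Decidable P) f →
             sum (List.map f (filter P? (allSubsets n))) ≡ ∑ n λ X → weight (P? X) (f X)
sum-filter n P? f = trans (sum-map-filter P? f (allSubsets n)) (sum-allSubsets n _)

length≡sum : {A : Set} (xs : List A) → length xs ≡ sum (List.map (const 1) xs)
length≡sum []       = refl
length≡sum (_ ∷ xs) = cong suc (length≡sum xs)

length-filter-allSubsets : ∀ n {P : Pred (Subset n) 0ℓ} (P? : Decidable P) →
  length (filter P? (allSubsets n)) ≡ ∑ n λ X → weight (P? X) 1
length-filter-allSubsets n P? =
  trans (length≡sum (filter P? (allSubsets n))) (sum-filter n P? (const 1))

-- Indicators of special subsets

empty : ∀ {n} → Subset n → ℕ
empty []            = 1
empty (outside ∷ X) = empty X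
empty (inside ∷ X)  = 0

full : ∀ {n} → Subset n → ℕ
full []            = 1
full (outside ∷ X) = 0
full (inside ∷ X)  = full X

-- Initial segments here, and intervals in `interval`; both include the empty set. Values in `ℕ`
-- rather than propositions let these indicators be multiplied and summed.
prefix : ∀ {n} → Subset n → ℕ
prefix []            = 1
prefix (outside ∷ X) = empty X
prefix (inside ∷ X)  = prefix X

interval : ∀ {n} → Subset n → ℕ
interval []            = 1
interval (outside ∷ X) = interval X
interval (inside ∷ X)  = prefix X

∑-0 : ∀ n → ∑ n (const 0) ≡ 0
∑-0 n = trans (∑-const n 0) (*-zeroʳ (2 ^ n))

∑-empty : ∀ n → ∑ n empty ≡ 1
∑-empty zero    = refl
∑-empty (suc n) = cong₂ _+_ (∑-empty n) (∑-0 n)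

∑-full : ∀ n → ∑ n full ≡ 1
∑-full zero    = refl
∑-full (suc n) = cong₂ _+_ (∑-0 n) (∑-full n)

∑-prefix : ∀ n → ∑ n prefix ≡ suc n
∑-prefix zero    = refl
∑-prefix (suc n) = cong₂ _+_ (∑-empty n) (∑-prefix n)

-- The exact value is 1 + n (n + 1) / 2. The square suffices: one more vertex adds `suc n`
-- intervals, less than the gap between consecutive squares.
∑-interval : ∀ n → ∑ n interval ≤ suc n * suc n
∑-interval zero    = ≤-refl
∑-interval (suc n) = begin
  ∑ n interval + ∑ n prefix        ≤⟨ +-mono-≤ (∑-interval n) (≤-reflexive (∑-prefix n)) ⟩
  suc n * suc n + suc n            ≤⟨ m≤m+n _ (suc (suc n)) ⟩
  suc n * suc n + suc n + suc (suc n) ≡⟨ square n ⟩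
  suc (suc n) * suc (suc n)        ∎
  where
  open ≤-Reasoning
  square : ∀ n → suc n * suc n + suc n + suc (suc n) ≡ suc (suc n) * suc (suc n)
  square = solve-∀

empty-⊥ : ∀ n → empty (⊥ {n}) ≡ 1
empty-⊥ zero    = refl
empty-⊥ (suc n) = empty-⊥ n

full-⊤ : ∀ n → full (⊤ {n}) ≡ 1
full-⊤ zero    = refl
full-⊤ (suc n) = full-⊤ n

¬Nonempty⇒empty : ∀ {n} {X : Subset n} → ¬ Nonempty X → empty X ≡ 1
¬Nonempty⇒empty {n} X≡∅ = trans (cong empty (Empty-unique X≡∅)) (empty-⊥ n)

all∈⇒full : ∀ {n} {X : Subset n} → (∀ i → i ∈ X) → full X ≡ 1
all∈⇒full {n} all∈ = trans (cong full (⊆-antisym ⊆⊤ λ _ → all∈ _)) (full-⊤ n)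

down-closed⇒prefix : ∀ {n} {X : Subset n} →
  (∀ {i j} → toℕ i < toℕ j → j ∈ X → i ∈ X) → 1 ≤ prefix X
down-closed⇒prefix {X = []}          down = ≤-refl
-- Any later member would force `zero` into the set.
down-closed⇒prefix {X = outside ∷ X} down =
  ≤-reflexive (sym (¬Nonempty⇒empty λ (j , j∈X) →
    contradiction (down {zero} (s≤s z≤n) (Vec.there j∈X)) λ ()))
down-closed⇒prefix {X = inside ∷ X}  down =
  down-closed⇒prefix λ i<j j∈X → drop-there (down (s≤s i<j) (Vec.there j∈X))

convex⇒interval : ∀ {n} {X : Subset n} →
  (∀ {i j k} → toℕ i < toℕ j → toℕ j < toℕ k → i ∈ X → k ∈ X → j ∈ X) → 1 ≤ interval X
convex⇒interval {X = []}          conv = ≤-refl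
convex⇒interval {X = outside ∷ X} conv =
  convex⇒interval λ i<j j<k i∈X k∈X →
    drop-there (conv (s≤s i<j) (s≤s j<k) (Vec.there i∈X) (Vec.there k∈X))
-- With `zero` fixed as the left end, convexity says that the rest is closed downwards.
convex⇒interval {X = inside ∷ X}  conv =
  down-closed⇒prefix λ i<j j∈X →
    drop-there (conv (s≤s z≤n) (s≤s i<j) Vec.here (Vec.there j∈X))

-- Membership and size in concatenated subsets

∈-++⁺ˡ : ∀ {a b} {S : Subset a} {Y : Subset b} {i} → i ∈ S → (i ↑ˡ b) ∈ (S ++ Y)
∈-++⁺ˡ {S = S} {Y} {i} i∈S = lookup⇒[]= _ _ (trans (lookup-++ˡ S Y i) ([]=⇒lookup i∈S))

∈-++⁺ʳ : ∀ {a b} (S : Subset a) {Y : Subset b} {i} → i ∈ Y → (a ↑ʳ i) ∈ (S ++ Y)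
∈-++⁺ʳ S {Y} {i} i∈Y = lookup⇒[]= _ _ (trans (lookup-++ʳ S Y i) ([]=⇒lookup i∈Y))

∈-++⁻ˡ : ∀ {a b} (S : Subset a) {Y : Subset b} {i} → (i ↑ˡ b) ∈ (S ++ Y) → i ∈ S
∈-++⁻ˡ S {Y} {i} i∈ = lookup⇒[]= _ _ (trans (sym (lookup-++ˡ S Y i)) ([]=⇒lookup i∈))

∈-++⁻ʳ : ∀ {a b} (S : Subset a) {Y : Subset b} {i} → (a ↑ʳ i) ∈ (S ++ Y) → i ∈ Y
∈-++⁻ʳ S {Y} {i} i∈ = lookup⇒[]= _ _ (trans (sym (lookup-++ʳ S Y i)) ([]=⇒lookup i∈))

∣++∣ : ∀ {a b} (S : Subset a) (Y : Subset b) → ∣ S ++ Y ∣ ≡ ∣ S ∣ + ∣ Y ∣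
∣++∣ []            Y = refl
∣++∣ (outside ∷ S) Y = ∣++∣ S Y
∣++∣ (inside ∷ S)  Y = cong suc (∣++∣ S Y)

-- Digraphs of levels

module _ {n} (ℓ : Fin n → ℕ) where

  -- All pairs of distinct levels are joined, not only consecutive ones. The arc relation is
  -- therefore transitive, and the fibres of `ℓ` are antichains.
  layered : Digraph
  layered = record { order = n ; arc = λ u v → ℓ u <ᵇ ℓ v }

  walk-level : ∀ {u w p} → Walk (Arc layered) u w p → ℓ u ≤ ℓ w
  walk-level stop             = ≤-refl
  walk-level (step {u} {v} r s) = ≤-trans (<⇒≤ (<ᵇ⇒< (ℓ u) (ℓ v) r)) (walk-level s)

  layered-acyclic : Acyclic layered
  layered-acyclic (u , w , p , (s , _) , r) =
    <-irrefl refl (<-≤-trans (<ᵇ⇒< (ℓ w) (ℓ u) r) (walk-level s))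

  -- Levels increase strictly along a walk. In the induction, a hit at the start of the remaining
  -- walk is the end `w` if that walk stops there, and otherwise lies strictly between.
  walk-interior : ∀ {u w p} {Q : Pred (Fin n) 0ℓ} → Walk (Arc layered) u w p → Any Q p →
                  Q u ⊎ Q w ⊎ ∃[ v ] (Q v × ℓ u < ℓ v × ℓ v < ℓ w)
  walk-interior stop       (here q)  = inj₁ q
  walk-interior (step r s) (here q)  = inj₁ q
  walk-interior (step {u} {v} r s) (there x) with walk-interior s x | s
  ... | inj₂ (inj₁ q)               | _ = inj₂ (inj₁ q)
  ... | inj₂ (inj₂ (x , q , l , l′)) | _ =
    inj₂ (inj₂ (x , q , <-trans (<ᵇ⇒< (ℓ u) (ℓ v) r) l , l′))
  ... | inj₁ q | stop          = inj₂ (inj₁ q)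
  ... | inj₁ q | step {v = v′} r′ s′ =
    inj₂ (inj₂ (v , q , <ᵇ⇒< (ℓ u) (ℓ v) r ,
                <-≤-trans (<ᵇ⇒< (ℓ v) (ℓ v′) r′) (walk-level s′)))

  -- The sequence `u`, `v`, `w` is itself a path, since increasing levels are joined by arcs.
  -- `ConvexSet` is a negative statement; decidability of membership makes the conclusion positive.
  between∈convex : ∀ {X} → ConvexSet layered X → ∀ {u v w} → u ∈ X → w ∈ X →
                   ℓ u < ℓ v → ℓ v < ℓ w → v ∈ X
  between∈convex {X} (_ , convex) {u} {v} {w} u∈X w∈X u<v v<w =
    decidable-stable (v ∈? X) λ v∉X → convex
      ( u , w , u ∷ v ∷ w ∷ [] , u∈X , w∈X
      , ( step (<⇒<ᵇ u<v) (step (<⇒<ᵇ v<w) stop)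
        , (distinct u<v ∷ distinct (<-trans u<v v<w) ∷ []) ∷ (distinct v<w ∷ []) ∷ [] ∷ [])
      , there (here v∉X))
    where
    distinct : ∀ {x y} → ℓ x < ℓ y → ¬ x ≡ y
    distinct x<y refl = <-irrefl refl x<y

  -- A level strictly between two others forces the upper one to be at least 2.
  levels≤1⇒convex : ∀ {X} → Nonempty X → (∀ {v} → v ∈ X → ℓ v ≤ 1) → ConvexSet layered X
  levels≤1⇒convex {X} X≢∅ low = X≢∅ , λ (u , w , p , u∈X , w∈X , (s , _) , x) →
    absurd u∈X w∈X (walk-interior s x)
    where
    absurd : ∀ {u w} → u ∈ X → w ∈ X →
             ¬ (u ∉ X ⊎ w ∉ X ⊎ ∃[ v ] (v ∉ X × ℓ u < ℓ v × ℓ v < ℓ w))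
    absurd u∈X w∈X (inj₁ u∉X)        = u∉X u∈X
    absurd u∈X w∈X (inj₂ (inj₁ w∉X)) = w∉X w∈X
    absurd u∈X w∈X (inj₂ (inj₂ (_ , _ , u<v , v<w))) =
      <⇒≱ v<w (≤-trans (low w∈X) (≤-trans (s≤s z≤n) u<v))

  -- The vertex `a` is a hub: a vertex on another level is adjacent to it, and a vertex on the same
  -- level reaches it through `b`. Abstract `R` and `Q` cover both the whole digraph and an induced
  -- subdigraph.
  two-levels⇒linked : {R : Rel (Fin n) 0ℓ} {Q : Pred (Fin n) 0ℓ} →
    (∀ {u v} → Q u → Q v → ℓ u < ℓ v → R u v) →
    ∀ {a b} → Q a → Q b → ℓ a < ℓ b →
    ∀ {u v} → Q u → Q v → EqClosure R u v
  two-levels⇒linked {R} {Q} R⁺ {a} {b} qa qb a<b qu qv = proj₁ (hub qu) ◅◅ proj₂ (hub qv)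
    where
    hub : ∀ {u} → Q u → EqClosure R u a × EqClosure R a u
    hub {u} qu with <-cmp (ℓ u) (ℓ a)
    ... | tri< u<a _ _ = fwd (R⁺ qu qa u<a) ◅ ε , bwd (R⁺ qu qa u<a) ◅ ε
    ... | tri> _ _ a<u = bwd (R⁺ qa qu a<u) ◅ ε , fwd (R⁺ qa qu a<u) ◅ ε
    ... | tri≈ _ u≡a _ =
      fwd (R⁺ qu qb u<b) ◅ bwd (R⁺ qa qb a<b) ◅ ε , fwd (R⁺ qa qb a<b) ◅ bwd (R⁺ qu qb u<b) ◅ ε
      where
      u<b : ℓ u < ℓ b
      u<b = subst (_< ℓ b) (sym u≡a) a<b

  layered-connected : ∀ a b → ℓ a < ℓ b → Connected layered
  layered-connected a b a<b = Fin-nonempty a , λ u v →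
    two-levels⇒linked {Q = λ _ → Unit} (λ _ _ → <⇒<ᵇ) tt tt a<b tt tt
    where
    Fin-nonempty : ∀ {k} → Fin k → 0 < k
    Fin-nonempty {suc _} _ = s≤s z≤n

  two-levels⇒connectedSet : ∀ {X a b} → a ∈ X → b ∈ X → ℓ a < ℓ b → ConnectedSet layered X
  two-levels⇒connectedSet a∈X b∈X a<b = (_ , a∈X) , λ u v →
    two-levels⇒linked (λ u∈X v∈X u<v → u∈X , v∈X , <⇒<ᵇ u<v) a∈X b∈X a<b

-- The ordinal sum of two antichains and a chain

module _ (a b m : ℕ) where

  level : Fin (a + (b + m)) → ℕ
  level = [ const 0 , [ const 1 , (λ k → 2 + toℕ k) ]′ ∘ splitAt b ]′ ∘ splitAt a

  tailed : Digraph
  tailed = layered level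

  A : Fin a → Vertex tailed
  A i = i ↑ˡ (b + m)

  B : Fin b → Vertex tailed
  B j = a ↑ʳ (j ↑ˡ m)

  C : Fin m → Vertex tailed
  C k = a ↑ʳ (b ↑ʳ k)

  level-A : ∀ i → level (A i) ≡ 0
  level-A i rewrite splitAt-↑ˡ a i (b + m) = refl

  level-B : ∀ j → level (B j) ≡ 1
  level-B j rewrite splitAt-↑ʳ a (b + m) (j ↑ˡ m) | splitAt-↑ˡ b j m = refl

  level-C : ∀ k → level (C k) ≡ 2 + toℕ k
  level-C k rewrite splitAt-↑ʳ a (b + m) (b ↑ʳ k) | splitAt-↑ʳ b m k = refl

  level-A<B : ∀ i j → level (A i) < level (B j)
  level-A<B i j rewrite level-A i | level-B j = s≤s z≤n

  level-B<C : ∀ j k → level (B j) < level (C k)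
  level-B<C j k rewrite level-B j | level-C k = s≤s (s≤s z≤n)

  level-C<C : ∀ {j k} → toℕ j < toℕ k → level (C j) < level (C k)
  level-C<C {j} {k} j<k rewrite level-C j | level-C k = s≤s (s≤s j<k)

  level≤1-off-tail : ∀ (S : Subset a) (T : Subset b) {v} → v ∈ S ++ (T ++ ⊥ {m}) → level v ≤ 1
  level≤1-off-tail S T {v} v∈ with splitAt a v in eq
  ... | inj₁ i = z≤n
  ... | inj₂ y with splitAt b y in eq′
  ...   | inj₁ j = ≤-refl
  ...   | inj₂ k with refl ← splitAt⁻¹-↑ʳ {a} eq | refl ← splitAt⁻¹-↑ʳ {b} eq′ =
    contradiction (∈-++⁻ʳ T (∈-++⁻ʳ S v∈)) ∉⊥

  off-tail-connectedConvex : ∀ {S : Subset a} {T : Subset b} → Nonempty S → Nonempty T →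
                             ConnectedConvexSet tailed (S ++ (T ++ ⊥))
  off-tail-connectedConvex {S} {T} (i , i∈S) (j , j∈T) =
      two-levels⇒connectedSet level (∈-++⁺ˡ i∈S) (∈-++⁺ʳ S (∈-++⁺ˡ j∈T)) (level-A<B i j)
    , levels≤1⇒convex level (_ , ∈-++⁺ˡ i∈S) (level≤1-off-tail S T)

  -- The product bounds the indicator of a convex set meeting the tail.
  convex-size : ∀ (S : Subset a) (T : Subset b) (U : Subset m) →
    ConvexSet tailed (S ++ (T ++ U)) →
    ∣ S ++ (T ++ U) ∣ ≤ a + b + m * ((empty S + full T) * interval U)
  convex-size S T U convex = begin
    ∣ S ++ (T ++ U) ∣       ≡⟨ ∣++∣ S (T ++ U) ⟩
    ∣ S ∣ + ∣ T ++ U ∣      ≡⟨ cong (λ k → ∣ S ∣ + k) (∣++∣ T U) ⟩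
    ∣ S ∣ + (∣ T ∣ + ∣ U ∣) ≡⟨ +-assoc (∣ S ∣) _ _ ⟨
    ∣ S ∣ + ∣ T ∣ + ∣ U ∣   ≤⟨ +-mono-≤ (+-mono-≤ (∣p∣≤n S) (∣p∣≤n T)) tail ⟩
    a + b + m * ((empty S + full T) * interval U) ∎
    where
    open ≤-Reasoning
    interval-U : 1 ≤ interval U
    interval-U = convex⇒interval λ i<j j<k i∈U k∈U →
      ∈-++⁻ʳ T (∈-++⁻ʳ S (between∈convex level convex
        (∈-++⁺ʳ S (∈-++⁺ʳ T i∈U)) (∈-++⁺ʳ S (∈-++⁺ʳ T k∈U)) (level-C<C i<j) (level-C<C j<k)))
    ends : Nonempty U → 1 ≤ empty S + full T
    ends (k , k∈U) with nonempty? S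
    ... | no S≡∅ = ≤-trans (≤-reflexive (sym (¬Nonempty⇒empty S≡∅))) (m≤m+n _ _)
    -- The whole second antichain lies between `A i` and `C k`, so convexity makes `T` full.
    ... | yes (i , i∈S) = ≤-trans (≤-reflexive (sym (all∈⇒full λ j →
            ∈-++⁻ˡ T (∈-++⁻ʳ S (between∈convex level convex
              (∈-++⁺ˡ i∈S) (∈-++⁺ʳ S (∈-++⁺ʳ T k∈U)) (level-A<B i j) (level-B<C j k))))))
          (m≤n+m _ (empty S))
    tail : ∣ U ∣ ≤ m * ((empty S + full T) * interval U)
    tail with nonempty? U
    ... | no U≡∅ = ≤-trans (≤-reflexive (trans (cong ∣_∣ (Empty-unique U≡∅)) (∣⊥∣≡0 m))) z≤n
    ... | yes U≢∅ = ≤-trans (≤-trans (∣p∣≤n U) (≤-reflexive (sym (*-identityʳ m))))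
                            (*-monoʳ-≤ m (*-mono-≤ (ends U≢∅) interval-U))

  -- The sum factors. If `S` is empty, `T` ranges over `2 ^ b` sets; if `T` is full, `S` ranges over
  -- `2 ^ a`; in both cases `U` has at most `suc m * suc m` choices.
  ∑-meeting-tail : (∑ a λ S → ∑ b λ T → ∑ m λ U → (empty S + full T) * interval U) ≤
                   (2 ^ a + 2 ^ b) * (suc m * suc m)
  ∑-meeting-tail = begin
    (∑ a λ S → ∑ b λ T → ∑ m λ U → (empty S + full T) * interval U)
      ≤⟨ ∑-mono a (λ S → ∑-mono b λ T → sum-U S T) ⟩
    (∑ a λ S → ∑ b λ T → (empty S + full T) * I)
      ≤⟨ ∑-mono a sum-T ⟩
    (∑ a λ S → I + I * 2 ^ b * empty S)
      ≤⟨ ∑-linear-≤ a (const 1) empty I (I * 2 ^ b) (λ S → ≤-reflexive (cong (_+ I * 2 ^ b * empty S) (sym (*-identityˡ I)))) ⟩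
    ∑ a (const 1) * I + I * 2 ^ b * ∑ a empty
      ≡⟨ cong₂ (λ x y → x * I + I * 2 ^ b * y) (∑-const a 1) (∑-empty a) ⟩
    2 ^ a * 1 * I + I * 2 ^ b * 1
      ≡⟨ collect (2 ^ a) (2 ^ b) I ⟩
    (2 ^ a + 2 ^ b) * I ∎
    where
    open ≤-Reasoning
    I = suc m * suc m
    collect : ∀ p q I → p * 1 * I + I * q * 1 ≡ (p + q) * I
    collect = solve-∀
    sum-U : ∀ S T → (∑ m λ U → (empty S + full T) * interval U) ≤ (empty S + full T) * I
    sum-U S T = begin
      (∑ m λ U → (empty S + full T) * interval U)
        ≤⟨ ∑-linear-≤ m (const 0) interval 0 (empty S + full T) (λ U → ≤-refl) ⟩
      ∑ m (const 0) * 0 + (empty S + full T) * ∑ m interval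
        ≡⟨ cong (_+ (empty S + full T) * ∑ m interval) (*-zeroʳ (∑ m (const 0))) ⟩
      (empty S + full T) * ∑ m interval
        ≤⟨ *-monoʳ-≤ (empty S + full T) (∑-interval m) ⟩
      (empty S + full T) * I ∎
    sum-T : ∀ S → (∑ b λ T → (empty S + full T) * I) ≤ I + I * 2 ^ b * empty S
    sum-T S = begin
      (∑ b λ T → (empty S + full T) * I)
        ≤⟨ ∑-linear-≤ b full (const (empty S)) I I (λ T → ≤-reflexive (swap (empty S) (full T) I)) ⟩
      ∑ b full * I + I * ∑ b (const (empty S))
        ≡⟨ cong₂ (λ x y → x * I + I * y) (∑-full b) (∑-const b (empty S)) ⟩
      1 * I + I * (2 ^ b * empty S)
        ≡⟨ cong₂ _+_ (*-identityˡ I) (sym (*-assoc I (2 ^ b) (empty S))) ⟩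
      I + I * 2 ^ b * empty S ∎
      where
      swap : ∀ e f I → (e + f) * I ≡ f * I + I * e
      swap = solve-∀

  -- Each listed set is charged `a + b` for its part in the antichains. The part in the chain is at
  -- most `m`, and is charged to the few triples counted in `∑-meeting-tail`.
  ∑-size : ∀ {P : Pred (Subset (order tailed)) 0ℓ} (P? : Decidable P) →
    (∀ {X} → P X → ConvexSet tailed X) →
    sum (List.map ∣_∣ (filter P? (allSubsets (order tailed)))) ≤
      length (filter P? (allSubsets (order tailed))) * (a + b) +
      m * ((2 ^ a + 2 ^ b) * (suc m * suc m))
  ∑-size {P} P? P⇒convex = begin
    sum (List.map ∣_∣ L)
      ≡⟨ sum-filter _ P? ∣_∣ ⟩
    ∑ (order tailed) (λ X → weight (P? X) ∣ X ∣)
      ≡⟨ ∑-++³ a b (λ X → weight (P? X) ∣ X ∣) ⟩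
    (∑ a λ S → ∑ b λ T → ∑ m λ U → weight (P? (S ++ (T ++ U))) ∣ S ++ (T ++ U) ∣)
      ≤⟨ (∑-linear-≤ a _ _ (a + b) m λ S → ∑-linear-≤ b _ _ (a + b) m λ T →
          ∑-linear-≤ m (λ U → weight (P? (S ++ (T ++ U))) 1) _ (a + b) m λ U → pointwise S T U) ⟩
    (∑ a λ S → ∑ b λ T → ∑ m λ U → weight (P? (S ++ (T ++ U))) 1) * (a + b) +
      m * (∑ a λ S → ∑ b λ T → ∑ m λ U → (empty S + full T) * interval U)
      ≤⟨ +-mono-≤ (≤-reflexive (cong (_* (a + b)) (sym (∑-++³ a b (λ X → weight (P? X) 1)))))
                  (*-monoʳ-≤ m ∑-meeting-tail) ⟩
    ∑ (order tailed) (λ X → weight (P? X) 1) * (a + b) + m * ((2 ^ a + 2 ^ b) * (suc m * suc m))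
      ≡⟨ cong (λ x → x * (a + b) + _) (length-filter-allSubsets _ P?) ⟨
    length L * (a + b) + m * ((2 ^ a + 2 ^ b) * (suc m * suc m)) ∎
    where
    open ≤-Reasoning
    L = filter P? (allSubsets (order tailed))
    pointwise : ∀ (S : Subset a) (T : Subset b) (U : Subset m) →
                weight (P? (S ++ (T ++ U))) ∣ S ++ (T ++ U) ∣ ≤
                weight (P? (S ++ (T ++ U))) 1 * (a + b) + m * ((empty S + full T) * interval U)
    pointwise S T U with P? (S ++ (T ++ U))
    ... | no _  = z≤n
    ... | yes p = ≤-trans (convex-size S T U (P⇒convex p))
      (+-monoˡ-≤ (m * ((empty S + full T) * interval U)) (≤-reflexive (sym (*-identityˡ (a + b)))))

-- Lower bound for the number of sets

module _ (t m : ℕ) where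

  -- Fixing vertex `zero` of each antichain as a member keeps both parts non-empty, hence the set
  -- connected and convex, and leaves `t` free vertices in each.
  many-off-tail : ∀ {P : Pred (Subset (order (tailed (suc t) (suc t) m))) 0ℓ} (P? : Decidable P) →
    (∀ {X} → ConnectedConvexSet (tailed (suc t) (suc t) m) X → P X) →
    2 ^ t * 2 ^ t ≤ length (filter P? (allSubsets (order (tailed (suc t) (suc t) m))))
  many-off-tail P? cc⇒P = begin
    2 ^ t * 2 ^ t
      ≡⟨ cong (2 ^ t *_) (trans (∑-const t 1) (*-identityʳ (2 ^ t))) ⟨
    2 ^ t * ∑ t (const 1)
      ≡⟨ ∑-const t _ ⟨
    (∑ t λ S → ∑ t λ T → 1)
      -- Of the sum over `U` only the term `⊥` is kept, and of the sum over `T` only the half with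
      -- `zero` inside.
      ≤⟨ ∑-mono t (λ S → ≤-trans (∑-mono t λ T → ≤-trans (accepted S T) (term≤∑ m _ ⊥)) (m≤n+m _ _)) ⟩
    (∑ t λ S → ∑ (suc t) λ T → ∑ m λ U → w ((inside ∷ S) ++ (T ++ U)))
      ≤⟨ m≤n+m _ _ ⟩
    (∑ (suc t) λ S → ∑ (suc t) λ T → ∑ m λ U → w (S ++ (T ++ U)))
      ≡⟨ ∑-++³ (suc t) (suc t) w ⟨
    ∑ _ w
      ≡⟨ length-filter-allSubsets _ P? ⟨
    length L ∎
    where
    open ≤-Reasoning
    L = filter P? (allSubsets (order (tailed (suc t) (suc t) m)))
    w : Subset (suc t + (suc t + m)) → ℕ
    w X = weight (P? X) 1
    accepted : ∀ (S T : Subset t) → 1 ≤ w ((inside ∷ S) ++ ((inside ∷ T) ++ ⊥))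
    accepted S T with P? ((inside ∷ S) ++ ((inside ∷ T) ++ ⊥))
    ... | yes _ = ≤-refl
    ... | no ¬p = contradiction
      (cc⇒P (off-tail-connectedConvex (suc t) (suc t) m
        {inside ∷ S} {inside ∷ T} (zero , Vec.here) (zero , Vec.here))) ¬p

-- Choice of the parameters

example : ℕ → Digraph
example s = tailed (suc (s * 6)) (suc (s * 6)) (s * s)

example-acyclic : ∀ s → Acyclic (example s)
example-acyclic s = layered-acyclic (level (suc (s * 6)) (suc (s * 6)) (s * s))

example-connected : ∀ s → Connected (example s)
example-connected s =
  layered-connected (level k k m) (A k k m zero) (B k k m zero) (level-A<B k k m zero zero)
  where
  k = suc (s * 6)
  m = s * s

n<2^n : ∀ n → n < 2 ^ n
n<2^n zero    = s≤s z≤n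
n<2^n (suc n) = begin-strict
  suc n           ≤⟨ n<2^n n ⟩
  2 ^ n           <⟨ m<m+n (2 ^ n) (m^n>0 2 n) ⟩
  2 ^ n + 2 ^ n   ≡⟨ cong (λ k → 2 ^ n + k) (+-identityʳ (2 ^ n)) ⟨
  2 * 2 ^ n       ∎
  where open ≤-Reasoning

-- This fixes the factor 6 in `example`: the left side has three factors, each at most the square of
-- `2 ^ s`.
tail-negligible : ∀ s → s * s * (suc (s * s) * suc (s * s)) ≤ 2 ^ (s * 6)
tail-negligible s = begin
  -- The strict inequality `s²<p²` is also the bound on `suc (s * s)`.
  s * s * (suc (s * s) * suc (s * s)) ≤⟨ *-mono-≤ (<⇒≤ s²<p²) (*-mono-≤ s²<p² s²<p²) ⟩
  p * p * (p * p * (p * p))           ≡⟨ sixth p ⟩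
  p ^ 6                               ≡⟨ ^-*-assoc 2 s 6 ⟩
  2 ^ (s * 6)                         ∎
  where
  open ≤-Reasoning
  p = 2 ^ s
  s²<p² : s * s < p * p
  s²<p² = *-mono-< (n<2^n s) (n<2^n s)
  sixth : ∀ p → p * p * (p * p * (p * p)) ≡ p * (p * (p * (p * (p * (p * 1)))))
  sixth = solve-∀

-- Per listed set, the antichains cost 12 s + 2. The chain costs `4 * (q * q)` in total, hence at
-- most 4 per set by `many-off-tail`. The remaining 6 is absorbed by `1 ≤ s`, which gives 18 s. A
-- predicate `P` between connected convex and convex treats both averages at once.
example-size : ∀ s {P : Pred (Subset (order (example s))) 0ℓ} (P? : Decidable P) →
  (∀ {X} → ConnectedConvexSet (example s) X → P X) →
  (∀ {X} → P X → ConvexSet (example s) X) →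
  1 ≤ s →
  sum (List.map ∣_∣ (filter P? (allSubsets (order (example s))))) ≤
    18 * s * length (filter P? (allSubsets (order (example s))))
example-size s P? cc⇒P P⇒convex 1≤s = begin
  sum (List.map ∣_∣ (filter P? (allSubsets (order (example s)))))
    ≤⟨ ∑-size (suc t) (suc t) m P? P⇒convex ⟩
  l * (suc t + suc t) + m * ((2 * q + 2 * q) * (suc m * suc m))
    ≡⟨ cong (λ k → l * (suc t + suc t) + k) (reorder m q (suc m * suc m)) ⟩
  l * (suc t + suc t) + 4 * (q * (m * (suc m * suc m)))
    ≤⟨ +-monoʳ-≤ (l * (suc t + suc t)) (*-monoʳ-≤ 4 (*-monoʳ-≤ q (tail-negligible s))) ⟩
  l * (suc t + suc t) + 4 * (q * q)
    ≤⟨ +-monoʳ-≤ (l * (suc t + suc t)) (*-monoʳ-≤ 4 (many-off-tail t m P? cc⇒P)) ⟩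
  l * (suc t + suc t) + 4 * l
    ≡⟨ collect l s ⟩
  12 * s * l + 6 * 1 * l
    ≤⟨ +-monoʳ-≤ (12 * s * l) (*-monoˡ-≤ l (*-monoʳ-≤ 6 1≤s)) ⟩
  12 * s * l + 6 * s * l
    ≡⟨ total l s ⟩
  18 * s * l ∎
  where
  open ≤-Reasoning
  t = s * 6
  m = s * s
  q = 2 ^ t
  l = length (filter P? (allSubsets (order (example s))))
  reorder : ∀ m q I → m * ((2 * q + 2 * q) * I) ≡ 4 * (q * (m * I))
  reorder = solve-∀
  collect : ∀ l s → l * (suc (s * 6) + suc (s * 6)) + 4 * l ≡ 12 * s * l + 6 * 1 * l
  collect = solve-∀
  total : ∀ l s → 12 * s * l + 6 * s * l ≡ 18 * s * l
  total = solve-∀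

-- From natural numbers to rational averages

-- Needed because `_≤[_]√_` squares the average, and multiplication by it preserves order only if it
-- is non-negative.
average-nonNeg : ∀ xs → ℚ.NonNegative (average xs)
average-nonNeg []       = _
average-nonNeg (x ∷ xs) = ℚ.normalize-nonNeg (sum (x ∷ xs)) (length (x ∷ xs))

-- Since `ℚ._/_` reduces to lowest terms, the comparison is made in the unnormalised rationals,
-- where it is a cross-multiplication.
/-≤-/1 : ∀ i n k .{{_ : ℕ.NonZero n}} → i ≤ k * n → + i ℚ./ n ℚ.≤ + k ℚ./ 1
/-≤-/1 i n@(suc _) k i≤kn = ℚ.toℚᵘ-cancel-≤ (begin
  ℚ.toℚᵘ (+ i ℚ./ n) ≃⟨ ℚ.toℚᵘ-fromℚᵘ (+ i ℚᵘ./ n) ⟩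
  + i ℚᵘ./ n         ≤⟨ ℚᵘ.*≤* cross ⟩
  + k ℚᵘ./ 1         ≃⟨ ℚ.toℚᵘ-fromℚᵘ (+ k ℚᵘ./ 1) ⟨
  ℚ.toℚᵘ (+ k ℚ./ 1) ∎)
  where
  open ℚᵘ.≤-Reasoning
  cross : + i ℤ.* + 1 ℤ.≤ + k ℤ.* + n
  cross rewrite ℤ.*-identityʳ (+ i) | sym (ℤ.pos-* k n) = ℤ.+≤+ i≤kn

/1-mono-≤ : ∀ {i j} → i ≤ j → + i ℚ./ 1 ℚ.≤ + j ℚ./ 1
/1-mono-≤ {i} {j} i≤j = /-≤-/1 i 1 j (≤-trans i≤j (≤-reflexive (sym (*-identityʳ j))))

average-≤ : ∀ k xs → sum xs ≤ k * length xs → average xs ℚ.≤ + k ℚ./ 1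
-- The default average 0 lies below every `k`.
average-≤ k []          _  = ℚ.nonNegative⁻¹ (+ k ℚ./ 1) {{ℚ.normalize-nonNeg k 1}}
average-≤ k xs@(_ ∷ _) ≤k = /-≤-/1 (sum xs) (length xs) k ≤k

/1-homo-* : ∀ i j → (i ℤ.* j) ℚ./ 1 ≡ (i ℚ./ 1) ℚ.* (j ℚ./ 1)
/1-homo-* i j = ℚ.toℚᵘ-injective (begin
  ℚ.toℚᵘ ((i ℤ.* j) ℚ./ 1)                ≈⟨ ℚ.toℚᵘ-fromℚᵘ ((i ℤ.* j) ℚᵘ./ 1) ⟩
  (i ℚᵘ./ 1) ℚᵘ.* (j ℚᵘ./ 1)              ≈⟨ ℚᵘ.*-cong (ℚ.toℚᵘ-fromℚᵘ (i ℚᵘ./ 1)) (ℚ.toℚᵘ-fromℚᵘ (j ℚᵘ./ 1)) ⟨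
  ℚ.toℚᵘ (i ℚ./ 1) ℚᵘ.* ℚ.toℚᵘ (j ℚ./ 1)  ≈⟨ ℚ.toℚᵘ-homo-* (i ℚ./ 1) (j ℚ./ 1) ⟨
  ℚ.toℚᵘ ((i ℚ./ 1) ℚ.* (j ℚ./ 1))        ∎)
  where open ℚᵘ.≃-Reasoning

average-≤√ : ∀ c s n xs → sum xs ≤ c * s * length xs → s * s ≤ n →
             average xs ≤[ + c ℚ./ 1 ]√ n
average-≤√ c s n xs ≤cs s²≤n = begin
  x ℚ.* x                                       ≤⟨ ℚ.*-monoˡ-≤-nonNeg x x≤ ⟩
  x ℚ.* (+ (c * s) ℚ./ 1)                       ≤⟨ ℚ.*-monoʳ-≤-nonNeg (+ (c * s) ℚ./ 1) x≤ ⟩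
  (+ (c * s) ℚ./ 1) ℚ.* (+ (c * s) ℚ./ 1)       ≡⟨ /1-homo-*ℕ (c * s) (c * s) ⟨
  + (c * s * (c * s)) ℚ./ 1                     ≤⟨ /1-mono-≤ (≤-trans (≤-reflexive (square c s)) (*-monoʳ-≤ (c * c) s²≤n)) ⟩
  + (c * c * n) ℚ./ 1                           ≡⟨ /1-homo-*ℕ (c * c) n ⟩
  (+ (c * c) ℚ./ 1) ℚ.* (+ n ℚ./ 1)             ≡⟨ cong (ℚ._* (+ n ℚ./ 1)) (/1-homo-*ℕ c c) ⟩
  (+ c ℚ./ 1) ℚ.* (+ c ℚ./ 1) ℚ.* (+ n ℚ./ 1)   ∎
  where
  open ℚ.≤-Reasoning
  x = average xs
  x≤ : x ℚ.≤ + (c * s) ℚ./ 1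
  x≤ = average-≤ (c * s) xs ≤cs
  instance
    x≥0 : ℚ.NonNegative x
    x≥0 = average-nonNeg xs
    cs≥0 : ℚ.NonNegative (+ (c * s) ℚ./ 1)
    cs≥0 = ℚ.normalize-nonNeg (c * s) 1
  /1-homo-*ℕ : ∀ i j → + (i * j) ℚ./ 1 ≡ (+ i ℚ./ 1) ℚ.* (+ j ℚ./ 1)
  /1-homo-*ℕ i j = trans (cong (ℚ._/ 1) (ℤ.pos-* i j)) (/1-homo-* (+ i) (+ j))
  square : ∀ c s → c * s * (c * s) ≡ c * c * (s * s)
  square = solve-∀

-- `CO` and `CC` are the two extreme choices of `P` in the hypothesis.
averages-≤√ : ∀ D c s → s * s ≤ order D →
  (∀ {P : Pred (Subset (order D)) 0ℓ} (P? : Decidable P) →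
    (∀ {X} → ConnectedConvexSet D X → P X) → (∀ {X} → P X → ConvexSet D X) →
    sum (List.map ∣_∣ (filter P? (allSubsets (order D)))) ≤
      c * s * length (filter P? (allSubsets (order D)))) →
  (s̄co D ≤[ + c ℚ./ 1 ]√ order D) × (s̄cc D ≤[ + c ℚ./ 1 ]√ order D)
averages-≤√ D c s s²≤n size≤ =
    sizes-≤√ (CO D) (size≤ (convexSet? D) proj₂ (λ x → x))
  , sizes-≤√ (CC D) (size≤ (connectedConvexSet? D) (λ x → x) proj₂)
  where
  sizes-≤√ : ∀ L → sum (List.map ∣_∣ L) ≤ c * s * length L →
             average (List.map ∣_∣ L) ≤[ + c ℚ./ 1 ]√ order D
  sizes-≤√ L size≤ = average-≤√ c s (order D) (List.map ∣_∣ L)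
    (subst (λ l → sum (List.map ∣_∣ L) ≤ c * s * l) (sym (length-map ∣_∣ L)) size≤) s²≤n

s²≤order : ∀ s → s * s ≤ order (example s)
s²≤order s = ≤-trans (m≤n+m (s * s) (suc (s * 6))) (m≤n+m _ (suc (s * 6)))

theorem2p1 : Σ[ F ∈ Pred Digraph 0ℓ ]
    ( (∀ D → F D → Acyclic D × Connected D)
    × (∀ (N : ℕ) → ∃[ D ] (F D × N ℕ.≤ order D))
    × (Σ[ K ∈ ℚ ]
    ( 0ℚ ℚ.< K
    × (∀ D → F D → (s̄co D ≤[ K ]√ order D) × (s̄cc D ≤[ K ]√ order D)))))
theorem2p1 =
    -- Starting from `suc r` provides the `1 ≤ s` of `example-size`.
    (λ D → ∃[ r ] D ≡ example (suc r))
  , (λ { _ (r , refl) → example-acyclic (suc r) , example-connected (suc r) })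
  , (λ N → example (suc N) , (N , refl) ,
           ≤-trans (n≤1+n N) (≤-trans (m≤m*n (suc N) (suc N)) (s²≤order (suc N))))
  , + 18 ℚ./ 1
  , ℚ.positive⁻¹ (+ 18 ℚ./ 1)
  , λ { _ (r , refl) →
          averages-≤√ (example (suc r)) 18 (suc r) (s²≤order (suc r))
            λ P? cc⇒P P⇒convex → example-size (suc r) P? cc⇒P P⇒convex (s≤s z≤n) }
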